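{- Let $G$ be a connected graph (possibly infinite) and let $r,v\in V(G)$. If $w\in\mathbb{R}_{\geq 0}^{V(G)}$ is edge-reachable from $\mathds{1}_{\{r\}}$, then \[ w(v)\leq \frac{1}{d_G(r,v)+1}. \]
   Context: A weight distribution on a graph $G$ is a function $w\in\mathbb{R}_{\geq 0}^{V(G)}$; for $S\subseteq V(G)$ write $w(S)=\sum_{x\in S}w(x)$. For $S\subseteq V(G)$, $\mathds{1}_S$ is the weight distribution with value $1$ on $S$ and $0$ elsewhere. For a finite nonempty set $T\subseteq V(G)$ inducing a connected subgraph, the sharing move on $T$ changes $w$ to $w'$ where $w'(x)=w(T)/|T|$ for $x\in T$ and $w'(x)=w(x)$ for $x\notin T$. An edge-sharing move is a sharing move on $T=\{x,y\}$ where $xy\in E(G)$. A weight distribution $w'$ is edge-reachable from $w$ if some finite sequence of edge-sharing moves changes $w$ to $w'$. $d_G(u,v)$ denotes the length of a shortest $u$–$v$ path in $G$. -}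

module Defs where

open import Level using (0ℓ)
open import Data.Nat using (ℕ; zero; suc)
import Data.Nat as ℕ
open import Data.Integer using (+_)
open import Data.Rational using (ℚ; _+_; _*_; ½; 0ℚ; 1ℚ; _/_)
open import Data.Product using (Σ; ∃; _×_; _,_)
open import Relation.Binary.PropositionalEquality using (_≡_; _≢_)
open import Relation.Binary.Construct.Closure.ReflexiveTransitive using (Star)
open import Relation.Nullary using (¬_)

record Graph : Set₁ where
  field
    V     : Set
    _~_   : V → V → Set
    sym   : ∀ {x y} → x ~ y → y ~ x
    irrefl : ∀ {x} → ¬ (x ~ x)

module _ (G : Graph) where
  open Graph G

  data Walk : V → V → ℕ → Set where
    []  : ∀ {x} → Walk x x zero
    _∷_ : ∀ {x y z n} → x ~ y → Walk y z n → Walk x z (suc n)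

  Connected : Set
  Connected = ∀ x y → ∃ λ n → Walk x y n

  IsDist : V → V → ℕ → Set
  IsDist u v d = Walk u v d × (∀ m → Walk u v m → d ℕ.≤ m)

  Weight : Set
  Weight = V → ℚ

  IsIndicator : V → Weight → Set
  IsIndicator r w = (w r ≡ 1ℚ) × (∀ z → z ≢ r → w z ≡ 0ℚ)

  EdgeShare : Weight → Weight → Set
  EdgeShare w w' = Σ V λ x → Σ V λ y → (x ~ y) ×
    (w' x ≡ (w x + w y) * ½) × (w' y ≡ (w x + w y) * ½) ×
    (∀ z → z ≢ x → z ≢ y → w' z ≡ w z)

  EdgeReachable : Weight → Weight → Set
  EdgeReachable = Star EdgeShare

{-# OPTIONS --safe #-}
-- For distinct vertices x₁,…,xₖ such that every walk from r to xᵢ has length at least nᵢ,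
-- every reachable w satisfies
--     Σ w(xᵢ) + Π nᵢ/(nᵢ+1) ≤ 1,
-- and k = 1 is the theorem.  The product is the probability that independent critical
-- geometric Galton–Watson processes started at the xᵢ all die out, the i-th one before
-- generation nᵢ.  The inequality survives a sharing move on xy because the only interesting
-- case is x ∈ S, y ∉ S, where the new weight of S is the average of the old weights of S ∖ x
-- and S ∪ y.  If n bounds the distance of x from below, then n − 1 bounds that of y, and
-- pₙ = n/(n+1) satisfies 2pₙ ≤ 1 + pₙ₋₁pₙ.
module Submission where

open import Defs
open import Data.Nat using (ℕ; zero; suc; pred; z≤n)
import Data.Nat as ℕ
import Data.Nat.Properties as ℕ
open import Data.Nat.Tactic.RingSolver using (solve-∀)
open import Data.Integer using (+_)
import Data.Integer as ℤ
open import Data.Rational using (ℚ; _≤_; _/_; _+_; _*_; _-_; ½; 0ℚ; 1ℚ; toℚᵘ; nonNegative)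
open import Data.Rational.Properties
open import Data.Rational.Solver using (module +-*-Solver)
open import Data.Rational.Unnormalised using (mkℚᵘ; *≡*; *≤*)
import Data.Rational.Unnormalised as ℚᵘ
import Data.Rational.Unnormalised.Properties as ℚᵘ
open import Data.Product using (∃₂; _×_; _,_; proj₁; proj₂)
open import Data.List using (List; []; _∷_; map; foldr; _++_)
open import Data.List.Membership.Propositional using (_∈_; _∉_)
open import Data.List.Membership.Propositional.Properties using (∈-map⁻; ∈-∃++)
open import Data.List.Relation.Unary.All using (All; []; _∷_)
import Data.List.Relation.Unary.All as All
import Data.List.Relation.Unary.All.Properties as All
open import Data.List.Relation.Unary.Any using (here; there)
open import Data.List.Relation.Unary.AllPairs using ([]; _∷_; tail)
open import Data.List.Relation.Unary.Unique.Propositional using (Unique)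
open import Data.List.Relation.Binary.Permutation.Propositional
  using (_↭_; ↭-sym; ↭-trans; ↭-prep; ↭⇒↭ₛ)
open import Data.List.Relation.Binary.Permutation.Propositional.Properties
  using (shift; map⁺; All-resp-↭; ∈-resp-↭)
import Data.List.Relation.Binary.Permutation.Setoid.Properties as Setoid↭
open import Relation.Binary.Construct.Closure.ReflexiveTransitive using (ε; _◅_)
open import Relation.Binary.PropositionalEquality
  using (_≡_; _≢_; refl; sym; trans; cong; cong₂; setoid; module ≡-Reasoning)
open import Relation.Nullary using (Dec; yes; no; contradiction)
open import Relation.Nullary.Decidable using (decidable-stable; ¬¬-excluded-middle)
open import Function using (_∘_)

-- Vertices need not have decidable equality, so membership in a list cannot be decided outright.
-- Comparison of rationals is decidable, hence stable under double negation, so excluded middle for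
-- any `A` may be used towards such a goal.
≤-by-cases : ∀ {a} {A : Set a} {p q : ℚ} → (Dec A → p ≤ q) → p ≤ q
≤-by-cases {p = p} {q} f =
  decidable-stable (p ≤? q) λ p≰q → ¬¬-excluded-middle λ a? → p≰q (f a?)

-- Survival and extinction probabilities of the Galton-Watson process

hit escape : ℕ → ℚ
hit n = + 1 / suc n
escape n = 1ℚ - hit n

-- With `hit n` as the probability of surviving to generation n, this is the recursion h' = h/(1 +
-- h). In the unnormalised rationals no gcd intervenes, and clearing denominators leaves a
-- polynomial identity over ℕ.
hit-suc : ∀ n → hit (suc n) * (1ℚ + hit n) ≡ hit n
hit-suc n = toℚᵘ-injective (begin-equality
  toℚᵘ (hit (suc n) * (1ℚ + hit n))
    ≃⟨ toℚᵘ-homo-* (hit (suc n)) (1ℚ + hit n) ⟩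
  toℚᵘ (hit (suc n)) ℚᵘ.* toℚᵘ (1ℚ + hit n)
    ≃⟨ ℚᵘ.*-cong (toℚᵘ-fromℚᵘ (mkℚᵘ (+ 1) (suc n)))
         (ℚᵘ.≃-trans (toℚᵘ-homo-+ 1ℚ (hit n))
           (ℚᵘ.+-cong (ℚᵘ.≃-refl {toℚᵘ 1ℚ}) (toℚᵘ-fromℚᵘ (mkℚᵘ (+ 1) n)))) ⟩
  mkℚᵘ (+ 1) (suc n) ℚᵘ.* (toℚᵘ 1ℚ ℚᵘ.+ mkℚᵘ (+ 1) n)
    ≃⟨ *≡* (cong +_ (ℕ-identity n)) ⟩
  mkℚᵘ (+ 1) n
    ≃⟨ toℚᵘ-fromℚᵘ (mkℚᵘ (+ 1) n) ⟨
  toℚᵘ (hit n) ∎)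
  where
  open ℚᵘ.≤-Reasoning
  ℕ-identity : ∀ n → suc (n ℕ.+ (n ℕ.+ 0 ℕ.+ 1 ℕ.+ 0) ℕ.* suc n)
                   ≡ suc (n ℕ.+ 0 ℕ.+ suc n ℕ.* suc (n ℕ.+ 0) ℕ.+ 0)
  ℕ-identity = solve-∀

hit-nonNeg : ∀ n → 0ℚ ≤ hit n
hit-nonNeg n = nonNegative⁻¹ (hit n) {{normalize-nonNeg 1 (suc n)}}

hit-≤1 : ∀ n → hit n ≤ 1ℚ
hit-≤1 n = toℚᵘ-cancel-≤ (begin
  toℚᵘ (hit n)  ≃⟨ toℚᵘ-fromℚᵘ (mkℚᵘ (+ 1) n) ⟩
  mkℚᵘ (+ 1) n  ≤⟨ *≤* (ℤ.+≤+ (ℕ.s≤s z≤n)) ⟩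
  toℚᵘ 1ℚ       ∎)
  where open ℚᵘ.≤-Reasoning

escape-≤1 : ∀ n → escape n ≤ 1ℚ
escape-≤1 n = begin
  1ℚ - hit n ≤⟨ +-monoʳ-≤ 1ℚ (neg-antimono-≤ (hit-nonNeg n)) ⟩
  1ℚ ∎
  where open ≤-Reasoning

escape-nonNeg : ∀ n → 0ℚ ≤ escape n
escape-nonNeg n = begin
  0ℚ         ≡⟨ +-inverseʳ 1ℚ ⟨
  1ℚ - 1ℚ    ≤⟨ +-monoʳ-≤ 1ℚ (neg-antimono-≤ (hit-≤1 n)) ⟩
  1ℚ - hit n ∎
  where open ≤-Reasoning

-- Equivalently p' = 1/(2 - p), one more iteration of the offspring generating function 1/(2 - s).
-- The two sides differ by h - h'(1 + h), which vanishes by `hit-suc`.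
escape-suc : ∀ n → escape (suc n) + escape (suc n) ≡ 1ℚ + escape n * escape (suc n)
escape-suc n = begin
  (1ℚ - h') + (1ℚ - h')
    ≡⟨ solve 2 (λ h h' → (con 1ℚ :- h') :+ (con 1ℚ :- h')
         := con 1ℚ :+ (con 1ℚ :- h) :* (con 1ℚ :- h') :+ (h :- h' :* (con 1ℚ :+ h))) refl h h' ⟩
  1ℚ + (1ℚ - h) * (1ℚ - h') + (h - h' * (1ℚ + h))
    ≡⟨ cong (λ t → 1ℚ + (1ℚ - h) * (1ℚ - h') + (h - t)) (hit-suc n) ⟩
  1ℚ + (1ℚ - h) * (1ℚ - h') + (h - h)
    ≡⟨ cong (λ t → 1ℚ + (1ℚ - h) * (1ℚ - h') + t) (+-inverseʳ h) ⟩
  1ℚ + (1ℚ - h) * (1ℚ - h') + 0ℚ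
    ≡⟨ +-identityʳ _ ⟩
  1ℚ + (1ℚ - h) * (1ℚ - h') ∎
  where
  open ≡-Reasoning
  open +-*-Solver
  h = hit n
  h' = hit (suc n)

escape-pred : ∀ n → escape n + escape n ≤ 1ℚ + escape (pred n) * escape n
-- Both `escape zero` and `escape (pred zero)` compute to 0, so the claim is 0 ≤ 1.
escape-pred zero = nonNegative⁻¹ 1ℚ
escape-pred (suc n) = ≤-reflexive (escape-suc n)

-- Here `a` and `b` are the old weights of x and y, `p` and `p'` their factors, `m` and `g` the mass
-- and gap of S ∖ x. Once 2p is replaced by 1 + p'p, twice the left side splits into the totals of S
-- ∖ x and S ∪ y.
average-step : ∀ a b m p p' {g} → 0ℚ ≤ g → p + p ≤ 1ℚ + p' * p →
  m + g ≤ 1ℚ → (b + (a + m)) + p' * (p * g) ≤ 1ℚ →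
  ((a + b) * ½ + m) + p * g ≤ 1ℚ
average-step a b m p p' {g} 0≤g 2p≤ without with' = begin
  ((a + b) * ½ + m) + p * g
    ≡⟨ solve 5 (λ a b m p g → ((a :+ b) :* con ½ :+ m) :+ p :* g
         := con ½ :* ((a :+ b :+ m :+ m) :+ (p :+ p) :* g)) refl a b m p g ⟩
  ½ * ((a + b + m + m) + (p + p) * g)
    ≤⟨ *-monoˡ-≤-nonNeg ½ (+-monoʳ-≤ (a + b + m + m)
         (*-monoʳ-≤-nonNeg g {{nonNegative 0≤g}} 2p≤)) ⟩
  ½ * ((a + b + m + m) + (1ℚ + p' * p) * g)
    ≡⟨ solve 6 (λ a b m p p' g →
         con ½ :* ((a :+ b :+ m :+ m) :+ (con 1ℚ :+ p' :* p) :* g)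
         := con ½ :* ((m :+ g) :+ ((b :+ (a :+ m)) :+ p' :* (p :* g)))) refl a b m p p' g ⟩
  ½ * ((m + g) + ((b + (a + m)) + p' * (p * g)))
    ≤⟨ *-monoˡ-≤-nonNeg ½ (+-mono-≤ without with') ⟩
  1ℚ ∎
  where
  open ≤-Reasoning
  open +-*-Solver

-- Mass and gap of finite families of points with bounds

module _ {A : Set} where

  mass : (A → ℚ) → List (A × ℕ) → ℚ
  mass w S = foldr _+_ 0ℚ (map (w ∘ proj₁) S)

  gap : List (A × ℕ) → ℚ
  gap S = foldr _*_ 1ℚ (map (escape ∘ proj₂) S)

  points : List (A × ℕ) → List A
  points = map proj₁

  total : (A → ℚ) → List (A × ℕ) → ℚ
  total w S = mass w S + gap S

  total-resp-↭ : ∀ w {S T} → S ↭ T → total w S ≡ total w T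
  total-resp-↭ w S↭T = cong₂ _+_
    (Setoid↭.foldr-commMonoid (setoid ℚ) +-0-isCommutativeMonoid (↭⇒↭ₛ (map⁺ _ S↭T)))
    (Setoid↭.foldr-commMonoid (setoid ℚ) *-1-isCommutativeMonoid (↭⇒↭ₛ (map⁺ _ S↭T)))

  mass-cong : ∀ {w w'} S → (∀ z → z ∈ points S → w' z ≡ w z) → mass w' S ≡ mass w S
  mass-cong []            w'≡w = refl
  mass-cong ((x , _) ∷ S) w'≡w =
    cong₂ _+_ (w'≡w x (here refl)) (mass-cong S λ z z∈S → w'≡w z (there z∈S))

  mass-zero : ∀ {w} S → (∀ z → z ∈ points S → w z ≡ 0ℚ) → mass w S ≡ 0ℚ
  mass-zero []            w≡0 = refl
  mass-zero ((x , _) ∷ S) w≡0 =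
    cong₂ _+_ (w≡0 x (here refl)) (mass-zero S λ z z∈S → w≡0 z (there z∈S))

  gap-nonNeg : ∀ S → 0ℚ ≤ gap S
  gap-nonNeg []            = nonNegative⁻¹ 1ℚ
  gap-nonNeg ((_ , n) ∷ S) = nonNegative⁻¹ (escape n * gap S)
    {{nonNeg*nonNeg⇒nonNeg (escape n) {{nonNegative (escape-nonNeg n)}}
                           (gap S) {{nonNegative (gap-nonNeg S)}}}}

  gap-≤1 : ∀ S → gap S ≤ 1ℚ
  gap-≤1 []            = ≤-refl
  gap-≤1 ((_ , n) ∷ S) = begin
    escape n * gap S ≤⟨ *-monoʳ-≤-nonNeg (gap S) {{nonNegative (gap-nonNeg S)}} (escape-≤1 n) ⟩
    1ℚ * gap S       ≡⟨ *-identityˡ (gap S) ⟩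
    gap S            ≤⟨ gap-≤1 S ⟩
    1ℚ               ∎
    where open ≤-Reasoning

  -- Brings a chosen vertex to the head of the family; totals and admissibility do not depend on the
  -- order.
  extract : ∀ {x S} → x ∈ points S → ∃₂ λ n R → S ↭ (x , n) ∷ R
  extract x∈S with ∈-map⁻ proj₁ x∈S
  ... | (_ , n) , xn∈S , refl with ∈-∃++ xn∈S
  ...   | ys , zs , refl = n , ys ++ zs , shift _ ys zs

  ∉⇒≢ : ∀ {x z} {xs : List A} → z ∈ xs → x ∉ xs → z ≢ x
  ∉⇒≢ z∈xs x∉xs refl = x∉xs z∈xs

  Unique-∉ : ∀ {x} {xs : List A} → Unique (x ∷ xs) → x ∉ xs
  Unique-∉ (x≢xs ∷ _) x∈xs = All.lookup x≢xs x∈xs refl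

-- The invariant and its preservation under sharing moves

module _ (G : Graph) (r : Graph.V G) where
  open Graph G renaming (sym to ~-sym)

  -- A bound instead of the exact distance: it passes to any neighbour with a loss of one, whichever
  -- way the distance itself changes.
  LowerBound : V × ℕ → Set
  LowerBound (x , n) = ∀ m → Walk G r x m → n ℕ.≤ m

  Admissible : List (V × ℕ) → Set
  Admissible S = Unique (points S) × All LowerBound S

  Admissible-resp-↭ : ∀ {S T} → S ↭ T → Admissible S → Admissible T
  Admissible-resp-↭ S↭T (unique , bounds) =
    Setoid↭.Unique-resp-↭ (setoid V) (↭⇒↭ₛ (map⁺ proj₁ S↭T)) unique , All-resp-↭ S↭T bounds

  Admissible-tail : ∀ {s S} → Admissible (s ∷ S) → Admissible S
  Admissible-tail (_ ∷ unique , _ ∷ bounds) = unique , bounds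

  Walk-snoc : ∀ {x y z n} → Walk G x y n → y ~ z → Walk G x z (suc n)
  Walk-snoc []      e = e ∷ []
  Walk-snoc (d ∷ p) e = d ∷ Walk-snoc p e

  LowerBound-pred : ∀ {x y n} → x ~ y → LowerBound (x , n) → LowerBound (y , pred n)
  LowerBound-pred x~y n≤ m walk = ℕ.pred-mono-≤ (n≤ (suc m) (Walk-snoc walk (~-sym x~y)))

  -- All families are treated at once because the inequality for S after a move may rest on those
  -- for two other families before it.
  Bounded : Weight G → Set
  Bounded w = ∀ S → Admissible S → total w S ≤ 1ℚ

  indicator-bounded : ∀ {w} → IsIndicator G r w → Bounded w
  indicator-bounded {w} (w-r , w-off) S adm = ≤-by-cases {A = r ∈ points S} λ where
      (yes r∈S) → let n , R , S↭ = extract r∈S in begin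
        total w S             ≡⟨ total-resp-↭ w S↭ ⟩
        total w ((r , n) ∷ R) ≡⟨ at-root n R (Admissible-resp-↭ S↭ adm) ⟩
        1ℚ                    ∎
      (no r∉S) → begin
        mass w S + gap S ≡⟨ cong (_+ gap S) (mass-zero S λ z z∈S → w-off z (∉⇒≢ z∈S r∉S)) ⟩
        0ℚ + gap S       ≡⟨ +-identityˡ (gap S) ⟩
        gap S            ≤⟨ gap-≤1 S ⟩
        1ℚ               ∎
    where
    open ≤-Reasoning
    at-root : ∀ n R → Admissible ((r , n) ∷ R) → total w ((r , n) ∷ R) ≡ 1ℚ
    -- The empty walk at r forces n = 0, so the factor `escape 0` = 0 annihilates the gap, while the
    -- mass is the single 1 at r.
    at-root n R (unique , n≤ ∷ _) with z≤n ← n≤ 0 [] =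
      cong₂ _+_
        (cong₂ _+_ w-r (mass-zero R λ z z∈R → w-off z (∉⇒≢ z∈R (Unique-∉ unique))))
        (*-zeroˡ (gap R))

  module _ {w w' : Weight G} (bounded : Bounded w) where

    bounded-∈∉ : ∀ {x y S} → x ~ y → w' x ≡ (w x + w y) * ½ →
      (∀ z → z ≢ x → z ≢ y → w' z ≡ w z) →
      x ∈ points S → y ∉ points S → Admissible S → total w' S ≤ 1ℚ
    bounded-∈∉ {x} {y} {S} x~y w'x off x∈S y∉S adm with extract x∈S
    ... | n , R , S↭ = begin
      total w' S
        ≡⟨ total-resp-↭ w' S↭ ⟩
      (w' x + mass w' R) + escape n * gap R
        ≡⟨ cong (_+ escape n * gap R) (cong₂ _+_ w'x (mass-cong R λ z z∈R →
             off z (∉⇒≢ z∈R (Unique-∉ (proj₁ admR))) (∉⇒≢ (there z∈R) y∉xR))) ⟩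
      ((w x + w y) * ½ + mass w R) + escape n * gap R
        ≤⟨ average-step (w x) (w y) (mass w R) (escape n) (escape (pred n))
             (gap-nonNeg R) (escape-pred n)
             (bounded R (Admissible-tail admR))
             (bounded ((y , pred n) ∷ (x , n) ∷ R) admY) ⟩
      1ℚ ∎
      where
      open ≤-Reasoning
      admR : Admissible ((x , n) ∷ R)
      admR = Admissible-resp-↭ S↭ adm
      y∉xR : y ∉ x ∷ points R
      y∉xR = y∉S ∘ ∈-resp-↭ (↭-sym (map⁺ proj₁ S↭))
      -- The vertex y is new, so distinctness persists, and its bound is inherited from x along the
      -- edge.
      admY : Admissible ((y , pred n) ∷ (x , n) ∷ R)
      admY = All.¬Any⇒All¬ _ y∉xR ∷ proj₁ admR ,
             LowerBound-pred x~y (All.head (proj₂ admR)) ∷ proj₂ admR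

    -- The move only redistributes weight inside S, so mass and gap are unchanged and the old
    -- inequality for S applies.
    bounded-∈∈ : ∀ {x y S} → x ≢ y → w' x ≡ (w x + w y) * ½ → w' y ≡ (w x + w y) * ½ →
      (∀ z → z ≢ x → z ≢ y → w' z ≡ w z) →
      x ∈ points S → y ∈ points S → Admissible S → total w' S ≤ 1ℚ
    bounded-∈∈ {x} {y} {S} x≢y w'x w'y off x∈S y∈S adm with extract x∈S
    ... | n , R , S↭ with ∈-resp-↭ (map⁺ proj₁ S↭) y∈S
    ...   | here y≡x = contradiction (sym y≡x) x≢y
    ...   | there y∈R with extract y∈R
    ...     | m , Q , R↭ = begin
      total w' S
        ≡⟨ total-resp-↭ w' S↭xyQ ⟩
      (w' x + (w' y + mass w' Q)) + gap xyQ
        ≡⟨ cong (_+ gap xyQ) (cong₂ _+_ w'x (cong₂ _+_ w'y (mass-cong Q λ z z∈Q →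
             off z (∉⇒≢ (there z∈Q) (Unique-∉ unique)) (∉⇒≢ z∈Q (Unique-∉ (tail unique)))))) ⟩
      ((w x + w y) * ½ + ((w x + w y) * ½ + mass w Q)) + gap xyQ
        ≡⟨ cong (_+ gap xyQ) (solve 3 (λ a b c →
             (a :+ b) :* con ½ :+ ((a :+ b) :* con ½ :+ c) := a :+ (b :+ c))
             refl (w x) (w y) (mass w Q)) ⟩
      total w xyQ
        ≤⟨ bounded xyQ admQ ⟩
      1ℚ ∎
      where
      open ≤-Reasoning
      open +-*-Solver
      xyQ = (x , n) ∷ (y , m) ∷ Q
      S↭xyQ : S ↭ xyQ
      S↭xyQ = ↭-trans S↭ (↭-prep (x , n) R↭)
      admQ = Admissible-resp-↭ S↭xyQ adm
      unique = proj₁ admQ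

    bounded-∉∉ : ∀ {x y S} → (∀ z → z ≢ x → z ≢ y → w' z ≡ w z) →
      x ∉ points S → y ∉ points S → Admissible S → total w' S ≤ 1ℚ
    bounded-∉∉ {S = S} off x∉S y∉S adm = begin
      mass w' S + gap S
        ≡⟨ cong (_+ gap S) (mass-cong S λ z z∈S → off z (∉⇒≢ z∈S x∉S) (∉⇒≢ z∈S y∉S)) ⟩
      mass w S + gap S
        ≤⟨ bounded S adm ⟩
      1ℚ ∎
      where open ≤-Reasoning

    share-bounded : EdgeShare G w w' → Bounded w'
    share-bounded (x , y , x~y , w'x , w'y , off) S adm =
      ≤-by-cases {A = x ∈ points S} λ x∈? → ≤-by-cases {A = y ∈ points S} λ y∈? → cases x∈? y∈?
      where
      cases : Dec (x ∈ points S) → Dec (y ∈ points S) → total w' S ≤ 1ℚ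
      cases (yes x∈S) (yes y∈S) =
        bounded-∈∈ (λ { refl → irrefl x~y }) w'x w'y off x∈S y∈S adm
      cases (yes x∈S) (no y∉S)  = bounded-∈∉ x~y w'x off x∈S y∉S adm
      -- The move is symmetric: x and y exchange roles after commuting the sum in the average.
      cases (no x∉S)  (yes y∈S) =
        bounded-∈∉ (~-sym x~y) (trans w'y (cong (_* ½) (+-comm (w x) (w y))))
          (λ z z≢y z≢x → off z z≢x z≢y) y∈S x∉S adm
      cases (no x∉S)  (no y∉S)  = bounded-∉∉ off x∉S y∉S adm

  reachable-bounded : ∀ {w w'} → Bounded w → EdgeReachable G w w' → Bounded w'
  reachable-bounded bounded ε              = bounded
  reachable-bounded bounded (share ◅ rest) =
    reachable-bounded (share-bounded bounded share) rest

theorem1p1 : (G : Graph) → Connected G → (r v : Graph.V G) → (d : ℕ) → IsDist G r v d →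
    (w₀ w : Weight G) → IsIndicator G r w₀ → EdgeReachable G w₀ w →
    w v ≤ (+ 1) / suc d
theorem1p1 G _ r v d (_ , d≤) w₀ w indicator reach = begin
  w v
    -- The singleton family has total w v + (1 - hit d), with `con 0ℚ` and the factor `con 1ℚ`
    -- coming from the ends of the two folds. Adding hit d - 1 isolates w v.
    ≡⟨ solve 2 (λ a h → a := (a :+ con 0ℚ) :+ (con 1ℚ :- h) :* con 1ℚ :+ (h :- con 1ℚ))
         refl (w v) (hit d) ⟩
  total w S + (hit d - 1ℚ)
    ≤⟨ +-monoˡ-≤ (hit d - 1ℚ)
         (reachable-bounded G r (indicator-bounded G r indicator) reach S
           ([] ∷ [] , d≤ ∷ [])) ⟩
  1ℚ + (hit d - 1ℚ)
    ≡⟨ solve 1 (λ h → con 1ℚ :+ (h :- con 1ℚ) := h) refl (hit d) ⟩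
  hit d ∎
  where
  open ≤-Reasoning
  open +-*-Solver
  S = (v , d) ∷ []
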